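{- Let $q=4$ and let $k\ge 1$ be an integer. Let $S_{2k}=x+x^{4}+x^{4^2}+\cdots+x^{4^{2k-1}}\in\mathbb{F}_2[x]$. Then the polynomial \[ g(x)=x+S_{2k}(x)^{q^{2k}}+S_{2k}(x)^{q^k+3} \] is a permutation polynomial of $\mathbb{F}_{q^{3k}}=\mathbb{F}_{4^{3k}}$, i.e. the map $x\mapsto g(x)$ is a bijection of $\mathbb{F}_{4^{3k}}$.
   Context: $\mathbb{F}_m$ denotes the finite field with $m$ elements. A polynomial $f\in\mathbb{F}_m[x]$ is a permutation polynomial (PP) of $\mathbb{F}_m$ if the induced map $\mathbb{F}_m\to\mathbb{F}_m$, $x\mapsto f(x)$, is a bijection. -}

module Defs where

open import Algebra.Apartness.Bundles using (HeytingField; HeytingCommutativeRing)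
open import Algebra.Bundles using (CommutativeRing)
open import Algebra.Bundles.Raw using (RawSemiring)
open import Data.Fin.Base using (Fin; toℕ)
open import Data.List.Base using (List; []; _∷_; map)
open import Data.Nat.Base as ℕ using (ℕ; zero; suc)
open import Function.Bundles using (Inverse)
open import Function.Definitions using (Bijective)
open import Level using (Level; _⊔_)
open import Relation.Binary.PropositionalEquality using (setoid)

import Algebra.Definitions.RawSemiring as RawSemiringDefinitions

private
  variable
    c ℓ₁ ℓ₂ : Level

ring : HeytingField c ℓ₁ ℓ₂ → CommutativeRing c ℓ₁
ring F = HeytingCommutativeRing.commutativeRing (HeytingField.heytingCommutativeRing F)

-- The library's `HeytingField` has an apartness `x # y` equivalent to
-- invertibility of `x - y`; irreflexivity makes it nontrivial.  Together with
-- an enumeration by `Fin m` (hence decidable equality) tightness makes every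
-- nonzero element invertible, so this is the usual notion of a field with
-- exactly m elements.
HasOrder : HeytingField c ℓ₁ ℓ₂ → ℕ → Set (c ⊔ ℓ₁)
HasOrder F m = Inverse (CommutativeRing.setoid (ring F)) (setoid (Fin m))

module Polynomial {c ℓ : Level} (R : CommutativeRing c ℓ) where

  open CommutativeRing R

  -- Coefficients in order of increasing degree; trailing zeros are allowed and
  -- are identified by `_≈ᵖ_`.
  Poly : Set c
  Poly = List Carrier

  coeff : Poly → ℕ → Carrier
  coeff []      _       = 0#
  coeff (a ∷ p) zero    = a
  coeff (a ∷ p) (suc n) = coeff p n

  infix 4 _≈ᵖ_
  _≈ᵖ_ : Poly → Poly → Set ℓ
  p ≈ᵖ r = ∀ n → coeff p n ≈ coeff r n

  infixl 6 _+ᵖ_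
  _+ᵖ_ : Poly → Poly → Poly
  []      +ᵖ r       = r
  (a ∷ p) +ᵖ []      = a ∷ p
  (a ∷ p) +ᵖ (b ∷ r) = (a + b) ∷ (p +ᵖ r)

  infixl 7 _*ᵖ_
  _*ᵖ_ : Poly → Poly → Poly
  []      *ᵖ r = []
  (a ∷ p) *ᵖ r = map (a *_) r +ᵖ (0# ∷ (p *ᵖ r))

  rawSemiringᵖ : RawSemiring c ℓ
  rawSemiringᵖ = record
    { Carrier = Poly
    ; _≈_     = _≈ᵖ_
    ; _+_     = _+ᵖ_
    ; _*_     = _*ᵖ_
    ; 0#      = []
    ; 1#      = 1# ∷ []
    }

  open RawSemiringDefinitions rawSemiringᵖ public
    using () renaming (_^_ to _^ᵖ_; sum to sumᵖ)

  X : Poly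
  X = 0# ∷ 1# ∷ []

  eval : Poly → Carrier → Carrier
  eval []      x = 0#
  eval (a ∷ p) x = a + x * eval p x

  IsPermutationPolynomial : Poly → Set (c ⊔ ℓ)
  IsPermutationPolynomial f = Bijective _≈_ _≈_ (eval f)

q : ℕ
q = 4

-- The coefficients of S and g are images of 0, 1 ∈ 𝔽₂, so both are written
-- directly over the ring on which they are to act.
module _ {c ℓ : Level} (R : CommutativeRing c ℓ) where

  open Polynomial R

  S : ℕ → Poly
  S n = sumᵖ {n} (λ i → X ^ᵖ (q ℕ.^ toℕ i))

  g : ℕ → Poly
  g k = X +ᵖ S (2 ℕ.* k) ^ᵖ (q ℕ.^ (2 ℕ.* k)) +ᵖ S (2 ℕ.* k) ^ᵖ (q ℕ.^ k ℕ.+ 3)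

{-# OPTIONS --safe #-}

-- Write σ(z) = z^(q^k), so that σ³ = 1 on the field, and for s = S₂ₖ(x) put
-- a = s, b = σ(s), c = σ²(s).  Telescoping gives s⁴ + s = σ²(x) + x, and
-- s = T + σ(T) with T = Sₖ(x) gives a + b + c = 0.  Since g(x) = x + c + b a³,
-- these two relations yield
--
--   σ²(g(x)) + g(x) = b · (a b c).
--
-- The product of the three conjugates of the right-hand side is (a b c)⁴, so
-- g(x) determines a b c.  If a b c = 0 then s = 0; otherwise g(x) determines
-- b, hence s = σ²(b).  In both cases x = g(x) + c + b a³ is determined.

module Submission where

open import Defs
open import Algebra.Apartness.Bundles using (HeytingField)
open import Level using (Level)

open import Algebra.Bundles using (CommutativeRing)
open import Algebra.Definitions using (LeftInvertible)
open import Algebra.Solver.Ring.AlmostCommutativeRing using (fromCommutativeRing; _-Raw-AlmostCommutative⟶_)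
open import Data.Bool.Base using (Bool; true; false)
open import Data.Bool.Properties using (xor-∧-commutativeRing)
open import Data.Fin.Base using (Fin; zero; suc; toℕ; punchOut)
open import Data.Fin.Permutation using (Permutation′; permutation; _⟨$⟩ʳ_)
open import Data.Fin.Properties using (_≟_; any?; injective⇒≤; punchOut-injective; punchInᵢ≢i)
open import Data.List.Base using ([]; _∷_; map)
open import Data.Maybe.Base using (just; nothing)
open import Data.Nat.Base as ℕ using (ℕ; zero; suc)
open import Data.Product.Base using (∃; _,_; proj₁)
open import Data.Sum.Base using (_⊎_; inj₁; inj₂; [_,_]′)
open import Data.Vec.Functional using (Vector; replicate; removeAt)
open import Function.Base using (_∘_; id)
open import Function.Bundles using (Inverse)
open import Function.Definitions using (Bijective; Injective; Congruent)
open import Relation.Binary.Bundles using (Setoid)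
open import Relation.Binary.Definitions using (WeaklyDecidable)
open import Relation.Binary.PropositionalEquality.Core as ≡ using (_≡_)
open import Relation.Nullary.Decidable.Core using (yes; no)
open import Relation.Nullary.Negation.Core using (contradiction)

import Algebra.Properties.CommutativeMonoid.Sum as Sum
import Algebra.Properties.CommutativeSemiring.Exp as Exp
import Algebra.Properties.Group as GroupProperties
import Algebra.Properties.Semiring.Mult as Mult
import Algebra.Solver.Ring as RingSolver
import Data.Nat.Properties as ℕₚ
import Relation.Binary.PropositionalEquality.Properties as ≡ₚ
import Relation.Binary.Reasoning.Setoid as SetoidReasoning

private
  variable
    c ℓ ℓ₁ ℓ₂ : Level

-- Finite setoids

-- Pigeonhole: if `j` were missed, punching it out of the codomain would give an injection from
-- `Fin (suc n)` into `Fin n`.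
Fin-injective⇒surjective : ∀ {n} (f : Fin n → Fin n) → Injective _≡_ _≡_ f → ∀ j → ∃ λ i → f i ≡ j
Fin-injective⇒surjective {suc n} f f-inj j with any? (λ i → f i ≟ j)
... | yes hit = hit
... | no ¬hit = contradiction (injective⇒≤ avoid-injective) ℕₚ.1+n≰n
  where
  avoids : ∀ i → j ≡.≢ f i
  avoids i j≡fi = ¬hit (i , ≡.sym j≡fi)

  avoid-injective : Injective _≡_ _≡_ (λ i → punchOut (avoids i))
  avoid-injective {x} {y} eq = f-inj (punchOut-injective (avoids x) (avoids y) eq)

module FiniteSetoid {A : Setoid c ℓ} {m : ℕ} (enum : Inverse A (≡ₚ.setoid (Fin m))) where

  open Setoid A
  open Inverse enum using (to; from; to-cong; from-cong; strictlyInverseˡ; strictlyInverseʳ)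

  to-injective : ∀ {x y} → to x ≡ to y → x ≈ y
  to-injective {x} {y} eq =
    trans (sym (strictlyInverseʳ x)) (trans (from-cong eq) (strictlyInverseʳ y))

  -- Conjugating by the enumeration turns `f` into an injective self-map of `Fin m`, to which the
  -- pigeonhole principle applies.
  injective⇒bijective : ∀ {f} → Congruent _≈_ _≈_ f → Injective _≈_ _≈_ f → Bijective _≈_ _≈_ f
  injective⇒bijective {f} f-cong f-inj = f-inj , f-surj
    where
    f′-injective : Injective _≡_ _≡_ (to ∘ f ∘ from)
    f′-injective {i} {j} eq = ≡.trans (≡.sym (strictlyInverseˡ i))
      (≡.trans (to-cong (f-inj (to-injective eq))) (strictlyInverseˡ j))

    f-surj : ∀ y → ∃ λ x → ∀ {z} → z ≈ x → f z ≈ y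
    f-surj y with i , eq ← Fin-injective⇒surjective (to ∘ f ∘ from) f′-injective (to y) =
      from i , λ z≈x → trans (f-cong z≈x) (to-injective eq)

  -- Serves to reindex sums and products over the whole field by translations and scalings.
  toPermutation : ∀ {f g} → Congruent _≈_ _≈_ f → Congruent _≈_ _≈_ g →
                  (∀ x → f (g x) ≈ x) → (∀ x → g (f x) ≈ x) → Permutation′ m
  toPermutation {f} {g} f-cong g-cong fg gf =
    permutation (to ∘ f ∘ from) (to ∘ g ∘ from) (cancel f g f-cong fg) (cancel g f g-cong gf)
    where
    cancel : ∀ f g → Congruent _≈_ _≈_ f → (∀ x → f (g x) ≈ x) →
             ∀ i → to (f (from (to (g (from i))))) ≡ i
    cancel f g f-cong fg i = ≡.trans
      (to-cong (trans (f-cong (strictlyInverseʳ _)) (fg _))) (strictlyInverseˡ i)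

-- Evaluation of polynomials

module Evaluation (R : CommutativeRing c ℓ) where

  open CommutativeRing R hiding (zero)
  open Polynomial R
  open Exp commutativeSemiring using (_^_)
  open Sum +-commutativeMonoid using (sum)
  open SetoidReasoning setoid
  open import Algebra.Properties.CommutativeSemigroup +-commutativeSemigroup using (interchange)
  open import Algebra.Properties.CommutativeSemigroup *-commutativeSemigroup using (x∙yz≈y∙xz)

  eval-cong : ∀ p → Congruent _≈_ _≈_ (eval p)
  eval-cong []      x≈y = refl
  eval-cong (a ∷ p) x≈y = +-congˡ (*-cong x≈y (eval-cong p x≈y))

  eval-+ : ∀ p r x → eval (p +ᵖ r) x ≈ eval p x + eval r x
  eval-+ []      r       x = sym (+-identityˡ _)
  eval-+ (a ∷ p) []      x = sym (+-identityʳ _)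
  eval-+ (a ∷ p) (b ∷ r) x = begin
    (a + b) + x * eval (p +ᵖ r) x            ≈⟨ +-congˡ (*-congˡ (eval-+ p r x)) ⟩
    (a + b) + x * (eval p x + eval r x)      ≈⟨ +-congˡ (distribˡ _ _ _) ⟩
    (a + b) + (x * eval p x + x * eval r x)  ≈⟨ interchange _ _ _ _ ⟩
    (a + x * eval p x) + (b + x * eval r x)  ∎

  eval-map-* : ∀ a p x → eval (map (a *_) p) x ≈ a * eval p x
  eval-map-* a []      x = sym (zeroʳ a)
  eval-map-* a (b ∷ p) x = begin
    a * b + x * eval (map (a *_) p) x  ≈⟨ +-congˡ (*-congˡ (eval-map-* a p x)) ⟩
    a * b + x * (a * eval p x)         ≈⟨ +-congˡ (x∙yz≈y∙xz _ _ _) ⟩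
    a * b + a * (x * eval p x)         ≈⟨ distribˡ _ _ _ ⟨
    a * (b + x * eval p x)             ∎

  eval-* : ∀ p r x → eval (p *ᵖ r) x ≈ eval p x * eval r x
  eval-* []      r x = sym (zeroˡ _)
  eval-* (a ∷ p) r x = begin
    eval (map (a *_) r +ᵖ (0# ∷ (p *ᵖ r))) x            ≈⟨ eval-+ (map (a *_) r) _ x ⟩
    eval (map (a *_) r) x + (0# + x * eval (p *ᵖ r) x)  ≈⟨ +-cong (eval-map-* a r x) (+-identityˡ _) ⟩
    a * eval r x + x * eval (p *ᵖ r) x                  ≈⟨ +-congˡ (*-congˡ (eval-* p r x)) ⟩
    a * eval r x + x * (eval p x * eval r x)            ≈⟨ +-congˡ (*-assoc _ _ _) ⟨
    a * eval r x + (x * eval p x) * eval r x            ≈⟨ distribʳ _ _ _ ⟨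
    (a + x * eval p x) * eval r x                       ∎

  eval-1 : ∀ x → eval (1# ∷ []) x ≈ 1#
  eval-1 x = trans (+-congˡ (zeroʳ x)) (+-identityʳ 1#)

  eval-X : ∀ x → eval X x ≈ x
  eval-X x = trans (+-identityˡ _) (trans (*-congˡ (eval-1 x)) (*-identityʳ x))

  eval-^ : ∀ p n x → eval (p ^ᵖ n) x ≈ eval p x ^ n
  eval-^ p zero    x = eval-1 x
  eval-^ p (suc n) x = trans (eval-* p (p ^ᵖ n) x) (*-congˡ (eval-^ p n x))

  eval-sum : ∀ {n} (f : Vector Poly n) x → eval (sumᵖ f) x ≈ sum (λ i → eval (f i) x)
  eval-sum {zero}  f x = refl
  eval-sum {suc n} f x = trans (eval-+ (f zero) _ x) (+-congˡ (eval-sum (f ∘ suc) x))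

-- Rings of characteristic 2

HasCharacteristic2 : CommutativeRing c ℓ → Set ℓ
HasCharacteristic2 R = 1# + 1# ≈ 0#
  where open CommutativeRing R

module Characteristic2 (R : CommutativeRing c ℓ) (1+1≈0 : HasCharacteristic2 R) where

  open CommutativeRing R hiding (zero)
  open Exp commutativeSemiring
  open Sum +-commutativeMonoid using (sum; sum-cong-≋)
  open SetoidReasoning setoid

  private
    module Bool₂ = CommutativeRing xor-∧-commutativeRing

    ⟦_⟧₂ : Bool → Carrier
    ⟦ false ⟧₂ = 0#
    ⟦ true  ⟧₂ = 1#

    +-homo₂ : ∀ x y → ⟦ x Bool₂.+ y ⟧₂ ≈ ⟦ x ⟧₂ + ⟦ y ⟧₂
    +-homo₂ false y     = sym (+-identityˡ _)
    +-homo₂ true  false = sym (+-identityʳ _)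
    +-homo₂ true  true  = sym 1+1≈0

    *-homo₂ : ∀ x y → ⟦ x Bool₂.* y ⟧₂ ≈ ⟦ x ⟧₂ * ⟦ y ⟧₂
    *-homo₂ false y = sym (zeroˡ _)
    *-homo₂ true  y = sym (*-identityˡ _)

    -- Negation in the Boolean ring is the identity, so each of `0#` and `1#` has to be its own
    -- negative.
    neg-homo₂ : ∀ x → ⟦ Bool₂.- x ⟧₂ ≈ - ⟦ x ⟧₂
    neg-homo₂ false = GroupProperties.inverseʳ-unique +-group _ _ (+-identityˡ 0#)
    neg-homo₂ true  = GroupProperties.inverseʳ-unique +-group _ _ 1+1≈0

    morphism₂ : Bool₂.rawRing -Raw-AlmostCommutative⟶ fromCommutativeRing R
    morphism₂ = record
      { ⟦_⟧    = ⟦_⟧₂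
      ; +-homo = +-homo₂
      ; *-homo = *-homo₂
      ; -‿homo = neg-homo₂
      ; 0-homo = refl
      ; 1-homo = refl
      }

    _≟₂_ : WeaklyDecidable (λ x y → ⟦ x ⟧₂ ≈ ⟦ y ⟧₂)
    false ≟₂ false = just refl
    false ≟₂ true  = nothing
    true  ≟₂ false = nothing
    true  ≟₂ true  = just refl

  -- Taking coefficients in 𝔽₂ makes the solver decide identities modulo 2.
  module Solver₂ = RingSolver Bool₂.rawRing (fromCommutativeRing R) morphism₂ _≟₂_
  open Solver₂ using (solve; _:=_; _:+_; _:^_; con)

  x+y≈0⇒x≈y : ∀ {x y} → x + y ≈ 0# → x ≈ y
  x+y≈0⇒x≈y {x} {y} eq = begin
    x            ≈⟨ solve 2 (λ x y → x := (x :+ y) :+ y) refl x y ⟩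
    (x + y) + y  ≈⟨ +-congʳ eq ⟩
    0# + y       ≈⟨ +-identityˡ y ⟩
    y            ∎

  -- Powers with exponent `q ^ n` and partial traces

  ^q-homo-+ : ∀ x y → (x + y) ^ q ≈ x ^ q + y ^ q
  ^q-homo-+ = solve 2 (λ x y → (x :+ y) :^ 4 := x :^ 4 :+ y :^ 4) refl

  ^q^-suc : ∀ n x → x ^ (q ℕ.^ suc n) ≈ (x ^ q) ^ (q ℕ.^ n)
  ^q^-suc n x = sym (^-assocʳ x q (q ℕ.^ n))

  ^q^-homo-+ : ∀ n x y → (x + y) ^ (q ℕ.^ n) ≈ x ^ (q ℕ.^ n) + y ^ (q ℕ.^ n)
  ^q^-homo-+ zero    x y = trans (*-identityʳ _) (sym (+-cong (*-identityʳ _) (*-identityʳ _)))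
  ^q^-homo-+ (suc n) x y = begin
    (x + y) ^ (q ℕ.^ suc n)                    ≈⟨ ^q^-suc n (x + y) ⟩
    ((x + y) ^ q) ^ (q ℕ.^ n)                  ≈⟨ ^-congˡ (q ℕ.^ n) (^q-homo-+ x y) ⟩
    (x ^ q + y ^ q) ^ (q ℕ.^ n)                ≈⟨ ^q^-homo-+ n _ _ ⟩
    (x ^ q) ^ (q ℕ.^ n) + (y ^ q) ^ (q ℕ.^ n)  ≈⟨ +-cong (^q^-suc n x) (^q^-suc n y) ⟨
    x ^ (q ℕ.^ suc n) + y ^ (q ℕ.^ suc n)      ∎

  ^-^-comm : ∀ x m n → (x ^ m) ^ n ≈ (x ^ n) ^ m
  ^-^-comm x m n = begin
    (x ^ m) ^ n    ≈⟨ ^-assocʳ x m n ⟩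
    x ^ (m ℕ.* n)  ≈⟨ ^-congʳ x (ℕₚ.*-comm m n) ⟩
    x ^ (n ℕ.* m)  ≈⟨ ^-assocʳ x n m ⟨
    (x ^ n) ^ m    ∎

  ^q^-^q^ : ∀ m n x → (x ^ (q ℕ.^ m)) ^ (q ℕ.^ n) ≈ x ^ (q ℕ.^ (m ℕ.+ n))
  ^q^-^q^ m n x = trans (^-assocʳ x (q ℕ.^ m) (q ℕ.^ n)) (^-congʳ x (≡.sym (ℕₚ.^-distribˡ-+-* q m n)))

  -- The value at `x` of the polynomial `S n`; on a field of order `q ^ n` it is the trace to the
  -- subfield with four elements.
  Tr : ℕ → Carrier → Carrier
  Tr n x = sum {n} (λ i → x ^ (q ℕ.^ toℕ i))

  Tr-suc : ∀ n x → Tr (suc n) x ≈ x + Tr n (x ^ q)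
  Tr-suc n x = +-cong (*-identityʳ x) (sum-cong-≋ {n} (λ i → ^q^-suc (toℕ i) x))

  Tr-cong : ∀ n {x y} → x ≈ y → Tr n x ≈ Tr n y
  Tr-cong n x≈y = sum-cong-≋ {n} (λ i → ^-congˡ (q ℕ.^ toℕ i) x≈y)

  -- The sum is cut after `m` terms. With both lengths equal to `k` this yields s = T + σ(T).
  Tr-+ : ∀ m n x → Tr (m ℕ.+ n) x ≈ Tr m x + Tr n (x ^ (q ℕ.^ m))
  Tr-+ zero    n x = trans (Tr-cong n (sym (*-identityʳ x))) (sym (+-identityˡ _))
  Tr-+ (suc m) n x = begin
    Tr (suc m ℕ.+ n) x                               ≈⟨ Tr-suc (m ℕ.+ n) x ⟩
    x + Tr (m ℕ.+ n) (x ^ q)                         ≈⟨ +-congˡ (Tr-+ m n (x ^ q)) ⟩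
    x + (Tr m (x ^ q) + Tr n ((x ^ q) ^ (q ℕ.^ m)))  ≈⟨ +-assoc _ _ _ ⟨
    (x + Tr m (x ^ q)) + Tr n ((x ^ q) ^ (q ℕ.^ m))  ≈⟨ +-cong (Tr-suc m x) (Tr-cong n (^q^-suc m x)) ⟨
    Tr (suc m) x + Tr n (x ^ (q ℕ.^ suc m))          ∎

  -- For a variable `k` the exponent does not reduce to a successor; splitting off one factor `q`
  -- exposes a factor zero.
  0^q^ : ∀ k → 0# ^ (q ℕ.^ k) ≈ 0#
  0^q^ zero    = *-identityʳ 0#
  0^q^ (suc k) = trans (^q^-suc k 0#) (trans (^-congˡ (q ℕ.^ k) (zeroˡ _)) (0^q^ k))

  -- Raising to the power `q ^ k` is additive and commutes with other powers, so it passes through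
  -- the sum term by term.
  Tr-^q^ : ∀ n k x → Tr n (x ^ (q ℕ.^ k)) ≈ Tr n x ^ (q ℕ.^ k)
  Tr-^q^ zero    k x = sym (0^q^ k)
  Tr-^q^ (suc n) k x = begin
    Tr (suc n) (x ^ (q ℕ.^ k))                  ≈⟨ Tr-suc n _ ⟩
    x ^ (q ℕ.^ k) + Tr n ((x ^ (q ℕ.^ k)) ^ q)  ≈⟨ +-congˡ (Tr-cong n (^-^-comm x (q ℕ.^ k) q)) ⟩
    x ^ (q ℕ.^ k) + Tr n ((x ^ q) ^ (q ℕ.^ k))  ≈⟨ +-congˡ (Tr-^q^ n k (x ^ q)) ⟩
    x ^ (q ℕ.^ k) + Tr n (x ^ q) ^ (q ℕ.^ k)    ≈⟨ ^q^-homo-+ k _ _ ⟨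
    (x + Tr n (x ^ q)) ^ (q ℕ.^ k)              ≈⟨ ^-congˡ (q ℕ.^ k) (Tr-suc n x) ⟨
    Tr (suc n) x ^ (q ℕ.^ k)                    ∎

  -- The power `q` moves each summand to the next one, so in characteristic 2 all but the two
  -- outermost terms cancel in pairs.
  Tr-telescope : ∀ n x → Tr n x ^ q + Tr n x ≈ x ^ (q ℕ.^ n) + x
  Tr-telescope zero    x = begin
    0# ^ q + 0#  ≈⟨ solve 1 (λ x → con false :^ 4 :+ con false := x :^ 1 :+ x) refl x ⟩
    x ^ 1 + x    ∎
  Tr-telescope (suc n) x = begin
    Tr (suc n) x ^ q + Tr (suc n) x
      ≈⟨ +-cong (^-congˡ q (Tr-suc n x)) (Tr-suc n x) ⟩
    (x + t) ^ q + (x + t)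
      ≈⟨ solve 2 (λ x t → (x :+ t) :^ 4 :+ (x :+ t) := (t :^ 4 :+ t) :+ (x :^ 4 :+ x)) refl x t ⟩
    (t ^ q + t) + (x ^ q + x)
      ≈⟨ +-congʳ (Tr-telescope n (x ^ q)) ⟩
    ((x ^ q) ^ (q ℕ.^ n) + x ^ q) + (x ^ q + x)
      ≈⟨ solve 3 (λ u v x → (u :+ v) :+ (v :+ x) := u :+ x) refl _ _ _ ⟩
    (x ^ q) ^ (q ℕ.^ n) + x
      ≈⟨ +-congʳ (^q^-suc n x) ⟨
    x ^ (q ℕ.^ suc n) + x ∎
    where t = Tr n (x ^ q)

-- Finite fields

module FiniteField (F : HeytingField c ℓ₁ ℓ₂) {m : ℕ} (enum : HasOrder F m) where

  open HeytingField F using (tight; #⇒invertible)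
  open CommutativeRing (ring F) hiding (ring; zero)
  open GroupProperties +-group using (∙-cancelʳ; ε⁻¹≈ε)
  open Exp commutativeSemiring
  open Mult semiring using (_×_; ×1-homo-*; ×-homo-1)
  open Sum +-commutativeMonoid using (sum; sum-cong-≋; sum-permute; ∑-distrib-+; sum-replicate)
  open Inverse enum using (to; from; to-cong; from-cong; strictlyInverseˡ; strictlyInverseʳ)
  open FiniteSetoid enum
  open SetoidReasoning setoid

  private
    module Π = Sum *-commutativeMonoid

  -- Invertibility and zero divisors

  HasInverse : Carrier → Set _
  HasInverse = LeftInvertible _≈_ 1# _*_

  -- A search through the enumeration decides whether `x` has an inverse. If none is found, `x`
  -- cannot be apart from zero, and tightness makes it zero.
  zero-or-inverse : ∀ x → x ≈ 0# ⊎ HasInverse x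
  zero-or-inverse x with any? (λ i → to (from i * x) ≟ to 1#)
  ... | yes (i , eq) = inj₂ (from i , to-injective eq)
  ... | no ¬inverse  = inj₁ (proj₁ (tight x 0#) λ x#0 → ¬inverse (invert (#⇒invertible x#0)))
    where
    invert : (∃ λ y → _) → _
    invert (y , y[x-0]≈1 , _) = to y , to-cong (begin
      from (to y) * x  ≈⟨ *-cong (strictlyInverseʳ y) (sym (trans (+-congˡ ε⁻¹≈ε) (+-identityʳ x))) ⟩
      y * (x - 0#)     ≈⟨ y[x-0]≈1 ⟩
      1#               ∎)

  cancelˡ : ∀ {x y z} → HasInverse x → x * y ≈ x * z → y ≈ z
  cancelˡ {x} {y} {z} (x⁻¹ , x⁻¹x≈1) eq = begin
    y              ≈⟨ expand y ⟩
    x⁻¹ * (x * y)  ≈⟨ *-congˡ eq ⟩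
    x⁻¹ * (x * z)  ≈⟨ expand z ⟨
    z              ∎
    where
    expand : ∀ y → y ≈ x⁻¹ * (x * y)
    expand y = trans (sym (*-identityˡ y)) (trans (*-congʳ (sym x⁻¹x≈1)) (*-assoc _ _ _))

  noZeroDivisors : ∀ {x y} → x * y ≈ 0# → x ≈ 0# ⊎ y ≈ 0#
  noZeroDivisors {x} {y} xy≈0 with zero-or-inverse x
  ... | inj₁ x≈0 = inj₁ x≈0
  ... | inj₂ inv = inj₂ (cancelˡ inv (trans xy≈0 (sym (zeroʳ x))))

  x^n≈0⇒x≈0 : ∀ n {x} → x ^ n ≈ 0# → x ≈ 0#
  -- Here the hypothesis is that one equals zero, which collapses the ring.
  x^n≈0⇒x≈0 zero    {x} 1≈0  = trans (sym (*-identityʳ x)) (trans (*-congˡ 1≈0) (zeroʳ x))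
  x^n≈0⇒x≈0 (suc n) {x} eq   = [ id , x^n≈0⇒x≈0 n ]′ (noZeroDivisors eq)

  HasInverse-* : ∀ {x y} → HasInverse x → HasInverse y → HasInverse (x * y)
  HasInverse-* {x} {y} (x⁻¹ , x⁻¹x≈1) (y⁻¹ , y⁻¹y≈1) = y⁻¹ * x⁻¹ , (begin
    (y⁻¹ * x⁻¹) * (x * y)  ≈⟨ *-assoc _ _ _ ⟩
    y⁻¹ * (x⁻¹ * (x * y))  ≈⟨ *-congˡ (*-assoc _ _ _) ⟨
    y⁻¹ * ((x⁻¹ * x) * y)  ≈⟨ *-congˡ (*-congʳ x⁻¹x≈1) ⟩
    y⁻¹ * (1# * y)         ≈⟨ *-congˡ (*-identityˡ y) ⟩
    y⁻¹ * y                ≈⟨ y⁻¹y≈1 ⟩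
    1#                     ∎)

  HasInverse-∏ : ∀ {n} (f : Vector Carrier n) → (∀ i → HasInverse (f i)) → HasInverse (Π.sum f)
  HasInverse-∏ {zero}  f inv = 1# , *-identityˡ 1#
  HasInverse-∏ {suc n} f inv = HasInverse-* (inv zero) (HasInverse-∏ (f ∘ suc) (inv ∘ suc))

  -- Translation by 1 permutes the field, so it preserves the sum of all elements.
  m×1≈0 : m × 1# ≈ 0#
  m×1≈0 = ∙-cancelʳ (sum from) _ _ (begin
    m × 1# + sum from                ≈⟨ +-congʳ (sum-replicate m) ⟨
    sum (replicate m 1#) + sum from  ≈⟨ ∑-distrib-+ (replicate m 1#) from ⟨
    sum (λ i → 1# + from i)          ≈⟨ sum-cong-≋ (λ i → strictlyInverseʳ (1# + from i)) ⟨
    sum (λ i → from (π ⟨$⟩ʳ i))      ≈⟨ sum-permute from π ⟨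
    sum from                         ≈⟨ +-identityˡ _ ⟨
    0# + sum from                    ∎)
    where
    translate-inverse : ∀ {a b} → a + b ≈ 0# → ∀ x → a + (b + x) ≈ x
    translate-inverse a+b≈0 x = trans (sym (+-assoc _ _ x)) (trans (+-congʳ a+b≈0) (+-identityˡ x))

    π : Permutation′ m
    π = toPermutation +-congˡ +-congˡ
          (translate-inverse (-‿inverseʳ 1#)) (translate-inverse (-‿inverseˡ 1#))

  -- The multiple of one by `n ℕ.^ j` is the `j`-th power of `n × 1#`, and there are no zero
  -- divisors.
  n^j×1≈0⇒n×1≈0 : ∀ n j → (n ℕ.^ j) × 1# ≈ 0# → n × 1# ≈ 0#
  n^j×1≈0⇒n×1≈0 n zero    1×1≈0 = begin
    n × 1#         ≈⟨ *-identityʳ _ ⟨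
    (n × 1#) * 1#  ≈⟨ *-congˡ (trans (sym (×-homo-1 1#)) 1×1≈0) ⟩
    (n × 1#) * 0#  ≈⟨ zeroʳ _ ⟩
    0#             ∎
  n^j×1≈0⇒n×1≈0 n (suc j) eq =
    [ id , n^j×1≈0⇒n×1≈0 n j ]′ (noZeroDivisors (trans (sym (×1-homo-* n (n ℕ.^ j))) eq))

  private
    -- Multiplication by a unit x permutes the field and fixes 0; comparing the
    -- products of all nonzero elements (0 being replaced by 1) gives x^(m-1) ≈ 1.
    unit^[m-1]≈1 : ∀ {n} → m ≡ suc n → ∀ {x} → HasInverse x → x ^ n ≈ 1#
    unit^[m-1]≈1 {n} ≡.refl {x} inv@(x⁻¹ , x⁻¹x≈1) = begin
      x ^ n                                   ≈⟨ Π.sum-replicate n ⟨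
      Π.sum (replicate n x)                   ≈⟨ Π.sum-cong-≋ (λ j → weight-≢ (punchInᵢ≢i 0ᶠ j)) ⟨
      Π.sum (removeAt weight 0ᶠ)              ≈⟨ *-identityˡ _ ⟨
      1# * Π.sum (removeAt weight 0ᶠ)         ≈⟨ *-congʳ weight-0 ⟨
      weight 0ᶠ * Π.sum (removeAt weight 0ᶠ)  ≈⟨ Π.sum-remove {i = 0ᶠ} weight ⟨
      Π.sum weight                            ≈⟨ ∏weight≈1 ⟩
      1#                                      ∎
      where
      0ᶠ : Fin m
      0ᶠ = to 0#

      -- The factor by which `unit` changes when the index moves along `π`: it is `x`, except at the
      -- index of zero, which `π` fixes.
      weight : Fin m → Carrier
      weight i with i ≟ 0ᶠ
      ... | yes _ = 1#
      ... | no  _ = x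

      unit : Fin m → Carrier
      unit i with i ≟ 0ᶠ
      ... | yes _ = 1#
      ... | no  _ = from i

      weight-0 : weight 0ᶠ ≈ 1#
      weight-0 with 0ᶠ ≟ 0ᶠ
      ... | yes _  = refl
      ... | no 0≢0 = contradiction ≡.refl 0≢0

      weight-≢ : ∀ {i} → i ≡.≢ 0ᶠ → weight i ≈ x
      weight-≢ {i} i≢0 with i ≟ 0ᶠ
      ... | yes i≡0 = contradiction i≡0 i≢0
      ... | no  _   = refl

      from≈0⇒≡0 : ∀ {i} → from i ≈ 0# → i ≡ 0ᶠ
      from≈0⇒≡0 {i} eq = ≡.trans (≡.sym (strictlyInverseˡ i)) (to-cong eq)

      unit-inverse : ∀ i → HasInverse (unit i)
      unit-inverse i with i ≟ 0ᶠ
      ... | yes _   = 1# , *-identityˡ 1#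
      ... | no  i≢0 = [ (λ eq → contradiction (from≈0⇒≡0 eq) i≢0) , id ]′ (zero-or-inverse (from i))

      scale-inverse : ∀ {a b} → a * b ≈ 1# → ∀ z → a * (b * z) ≈ z
      scale-inverse ab≈1 z = trans (sym (*-assoc _ _ z)) (trans (*-congʳ ab≈1) (*-identityˡ z))

      π : Permutation′ m
      π = toPermutation *-congˡ *-congˡ
            (scale-inverse (trans (*-comm x x⁻¹) x⁻¹x≈1)) (scale-inverse x⁻¹x≈1)

      from-π : ∀ i → from (π ⟨$⟩ʳ i) ≈ x * from i
      from-π i = strictlyInverseʳ (x * from i)

      -- The two mixed cases are contradictory, since scaling by the invertible `x` sends zero, and
      -- nothing else, to zero.
      unit-π : ∀ i → unit (π ⟨$⟩ʳ i) ≈ weight i * unit i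
      unit-π i with (π ⟨$⟩ʳ i) ≟ 0ᶠ | i ≟ 0ᶠ
      ... | yes _    | yes _   = sym (*-identityˡ 1#)
      ... | no  _    | no  _   = from-π i
      ... | yes πi≡0 | no  i≢0 = contradiction
              (from≈0⇒≡0 (cancelˡ inv (begin
                x * from i       ≈⟨ from-π i ⟨
                from (π ⟨$⟩ʳ i)  ≈⟨ from-cong πi≡0 ⟩
                from 0ᶠ          ≈⟨ strictlyInverseʳ 0# ⟩
                0#               ≈⟨ zeroʳ x ⟨
                x * 0#           ∎)))
              i≢0
      ... | no  πi≢0 | yes i≡0 = contradiction
              (from≈0⇒≡0 (begin
                from (π ⟨$⟩ʳ i)  ≈⟨ from-π i ⟩
                x * from i       ≈⟨ *-congˡ (from-cong i≡0) ⟩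
                x * from 0ᶠ      ≈⟨ *-congˡ (strictlyInverseʳ 0#) ⟩
                x * 0#           ≈⟨ zeroʳ x ⟩
                0#               ∎))
              πi≢0

      -- Reindexing by `π` leaves the product of `unit` unchanged but also multiplies it by the
      -- product of `weight`; the former is invertible and cancels.
      ∏weight≈1 : Π.sum weight ≈ 1#
      ∏weight≈1 = cancelˡ (HasInverse-∏ unit unit-inverse) (begin
        Π.sum unit * Π.sum weight        ≈⟨ *-comm _ _ ⟩
        Π.sum weight * Π.sum unit        ≈⟨ Π.∑-distrib-+ weight unit ⟨
        Π.sum (λ i → weight i * unit i)  ≈⟨ Π.sum-cong-≋ unit-π ⟨
        Π.sum (λ i → unit (π ⟨$⟩ʳ i))    ≈⟨ Π.sum-permute unit π ⟨
        Π.sum unit                       ≈⟨ *-identityʳ _ ⟨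
        Π.sum unit * 1#                  ∎)

    -- The exponent is a separate variable so that it can be split into cases; order zero is
    -- excluded because `to x` would inhabit `Fin 0`.
    x^m≈x′ : ∀ n → m ≡ n → ∀ x → x ^ n ≈ x
    x^m≈x′ zero    ≡.refl x with () ← to x
    x^m≈x′ (suc n) m≡1+n  x with zero-or-inverse x
    ... | inj₁ x≈0 = trans (*-congʳ x≈0) (trans (zeroˡ _) (sym x≈0))
    ... | inj₂ inv = trans (*-congˡ (unit^[m-1]≈1 m≡1+n inv)) (*-identityʳ x)

  x^m≈x : ∀ x → x ^ m ≈ x
  x^m≈x = x^m≈x′ m ≡.refl

-- The polynomial `g` over a field of order `q ^ (3 * k)`

module Permutation (F : HeytingField c ℓ₁ ℓ₂) (k : ℕ) (enum : HasOrder F (q ℕ.^ (3 ℕ.* k))) where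

  open FiniteField F enum
  open CommutativeRing (ring F) hiding (ring; zero)
  open Exp commutativeSemiring
  open Mult semiring using (×1-homo-*)
  open Sum +-commutativeMonoid using (sum-cong-≋)
  open SetoidReasoning setoid
  open Polynomial (ring F) using (eval; X; _+ᵖ_; _^ᵖ_)
  open Evaluation (ring F)

  -- The order of the field, a power of four, annihilates one; hence so does four, and then two, as
  -- four is two times two.
  1+1≈0 : 1# + 1# ≈ 0#
  1+1≈0 = trans (+-congˡ (sym (+-identityʳ 1#)))
    ([ id , id ]′ (noZeroDivisors
      (trans (sym (×1-homo-* 2 2)) (n^j×1≈0⇒n×1≈0 q (3 ℕ.* k) m×1≈0))))

  open Characteristic2 (ring F) 1+1≈0
  open Solver₂ using (solve; _:=_; _:+_; _:*_; _:^_; con)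

  σ : Carrier → Carrier
  σ x = x ^ (q ℕ.^ k)

  σ-cong : Congruent _≈_ _≈_ σ
  σ-cong = ^-congˡ (q ℕ.^ k)

  σ-+ : ∀ x y → σ (x + y) ≈ σ x + σ y
  σ-+ = ^q^-homo-+ k

  σ-* : ∀ x y → σ (x * y) ≈ σ x * σ y
  σ-* x y = ^-distrib-* x y (q ℕ.^ k)

  2*k≡k+k : 2 ℕ.* k ≡ k ℕ.+ k
  2*k≡k+k = ≡.cong (k ℕ.+_) (ℕₚ.+-identityʳ k)

  σ² : ∀ x → σ (σ x) ≈ x ^ (q ℕ.^ (2 ℕ.* k))
  σ² x = trans (^q^-^q^ k k x) (^-congʳ x (≡.cong (q ℕ.^_) (≡.sym 2*k≡k+k)))

  σ³≈id : ∀ x → σ (σ (σ x)) ≈ x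
  σ³≈id x = begin
    σ (σ (σ x))              ≈⟨ σ² (σ x) ⟩
    -- The exponents add up to `k ℕ.+ 2 ℕ.* k`, which is `3 ℕ.* k` by computation, so the total
    -- power is the order of the field.
    σ x ^ (q ℕ.^ (2 ℕ.* k))  ≈⟨ ^q^-^q^ k (2 ℕ.* k) x ⟩
    x ^ (q ℕ.^ (3 ℕ.* k))    ≈⟨ x^m≈x x ⟩
    x                        ∎

  s : Carrier → Carrier
  s = Tr (2 ℕ.* k)

  s≈t+σt : ∀ x → s x ≈ Tr k x + σ (Tr k x)
  s≈t+σt x = begin
    s x                            ≡⟨ ≡.cong (λ n → Tr n x) 2*k≡k+k ⟩
    Tr (k ℕ.+ k) x                 ≈⟨ Tr-+ k k x ⟩
    Tr k x + Tr k (x ^ (q ℕ.^ k))  ≈⟨ +-congˡ (Tr-^q^ k k x) ⟩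
    Tr k x + σ (Tr k x)            ∎

  -- By `s≈t+σt` the element `s x` lies in the image of 1 + σ. In characteristic 2, (1 + σ + σ²)(1 +
  -- σ) = 1 + σ³, which vanishes as σ³ = 1.
  σ²s≈s+σs : ∀ x → σ (σ (s x)) ≈ s x + σ (s x)
  σ²s≈s+σs x = begin
    σ (σ (s x))                  ≈⟨ σ-cong (trans (σ-cong (s≈t+σt x)) (σ-+ t (σ t))) ⟩
    σ (σ t + σ (σ t))            ≈⟨ σ-+ _ _ ⟩
    σ (σ t) + σ (σ (σ t))        ≈⟨ +-congˡ (σ³≈id t) ⟩
    σ (σ t) + t                  ≈⟨ solve 3 (λ t u v → v :+ t := (t :+ u) :+ (u :+ v)) refl t (σ t) (σ (σ t)) ⟩
    (t + σ t) + (σ t + σ (σ t))  ≈⟨ +-cong (s≈t+σt x) (trans (σ-cong (s≈t+σt x)) (σ-+ t (σ t))) ⟨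
    s x + σ (s x)                ∎
    where t = Tr k x

  s⁴+s : ∀ x → s x ^ 4 + s x ≈ σ (σ x) + x
  s⁴+s x = trans (Tr-telescope (2 ℕ.* k) x) (+-congʳ (sym (σ² x)))

  -- The value of `g` in terms of `σ`: the exponent `q ^ (2 * k)` is `σ` applied twice, and
  -- `q ^ k + 3` splits into `σ` and a cube.
  G : Carrier → Carrier
  G x = (x + σ (σ (s x))) + σ (s x) * s x ^ 3

  eval-S : ∀ x → eval (S (ring F) (2 ℕ.* k)) x ≈ s x
  eval-S x = trans (eval-sum {2 ℕ.* k} (λ i → X ^ᵖ (q ℕ.^ toℕ i)) x)
    (sum-cong-≋ {2 ℕ.* k} λ i → trans (eval-^ X (q ℕ.^ toℕ i) x) (^-congˡ (q ℕ.^ toℕ i) (eval-X x)))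

  eval-S^ : ∀ n x → eval (S (ring F) (2 ℕ.* k) ^ᵖ n) x ≈ s x ^ n
  eval-S^ n x = trans (eval-^ (S (ring F) (2 ℕ.* k)) n x) (^-congˡ n (eval-S x))

  eval-g : ∀ x → eval (g (ring F) k) x ≈ G x
  eval-g x = begin
    eval (g (ring F) k) x
      ≈⟨ eval-+ (X +ᵖ S′ ^ᵖ (q ℕ.^ (2 ℕ.* k))) (S′ ^ᵖ (q ℕ.^ k ℕ.+ 3)) x ⟩
    eval (X +ᵖ S′ ^ᵖ (q ℕ.^ (2 ℕ.* k))) x + eval (S′ ^ᵖ (q ℕ.^ k ℕ.+ 3)) x
      ≈⟨ +-cong (eval-+ X (S′ ^ᵖ (q ℕ.^ (2 ℕ.* k))) x) (eval-S^ (q ℕ.^ k ℕ.+ 3) x) ⟩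
    (eval X x + eval (S′ ^ᵖ (q ℕ.^ (2 ℕ.* k))) x) + s x ^ (q ℕ.^ k ℕ.+ 3)
      ≈⟨ +-cong (+-cong (eval-X x) (trans (eval-S^ (q ℕ.^ (2 ℕ.* k)) x) (sym (σ² (s x)))))
                (^-homo-* (s x) (q ℕ.^ k) 3) ⟩
    G x ∎
    where S′ = S (ring F) (2 ℕ.* k)

  -- The norm of `s x` to the fixed field of `σ`, written a b c in the overview.
  N : Carrier → Carrier
  N x = (s x * σ (s x)) * σ (σ (s x))

  σ-N : ∀ x → σ (N x) ≈ N x
  σ-N x = begin
    σ (N x)                              ≈⟨ σ-* _ _ ⟩
    σ (s x * σ (s x)) * σ (σ (σ (s x)))  ≈⟨ *-cong (σ-* _ _) (σ³≈id (s x)) ⟩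
    (σ (s x) * σ (σ (s x))) * s x        ≈⟨ trans (*-comm _ _) (sym (*-assoc _ _ _)) ⟩
    N x                                  ∎

  σ²G+G≈σs*N : ∀ x → σ (σ (G x)) + G x ≈ σ (s x) * N x
  σ²G+G≈σs*N x = begin
    σ (σ (G x)) + G x
      ≈⟨ +-congʳ σ²G ⟩
    ((σ (σ x) + b) + a * c′ ^ 3) + ((x + c′) + b * a ^ 3)
      -- The terms are regrouped so that σ²(x) + x stands alone.
      ≈⟨ solve 5 (λ x′ x a b c → ((x′ :+ b) :+ a :* c :^ 3) :+ ((x :+ c) :+ b :* a :^ 3)
                              := (x′ :+ x) :+ (((b :+ a :* c :^ 3) :+ c) :+ b :* a :^ 3))
           refl (σ (σ x)) x a b c′ ⟩
    (σ (σ x) + x) + (((b + a * c′ ^ 3) + c′) + b * a ^ 3)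
      -- The two relations eliminate σ²(x) + x and `c′`; what remains is a polynomial identity in
      -- `a` and `b` over the field with two elements.
      ≈⟨ +-cong (sym (s⁴+s x))
           (+-congʳ (+-cong (+-congˡ (*-congˡ (^-congˡ 3 (σ²s≈s+σs x)))) (σ²s≈s+σs x))) ⟩
    (a ^ 4 + a) + (((b + a * (a + b) ^ 3) + (a + b)) + b * a ^ 3)
      ≈⟨ solve 2 (λ a b → (a :^ 4 :+ a) :+ (((b :+ a :* (a :+ b) :^ 3) :+ (a :+ b)) :+ b :* a :^ 3)
                        := b :* ((a :* b) :* (a :+ b))) refl a b ⟩
    b * ((a * b) * (a + b))
      ≈⟨ *-congˡ (*-congˡ (σ²s≈s+σs x)) ⟨
    b * N x ∎
    where
    a = s x
    b = σ a
    c′ = σ b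

    σ-^ : ∀ n z → σ (z ^ n) ≈ σ z ^ n
    σ-^ n z = ^-^-comm z n (q ℕ.^ k)

    σG : σ (G x) ≈ (σ x + a) + c′ * b ^ 3
    σG = begin
      σ (G x)                        ≈⟨ σ-+ _ _ ⟩
      σ (x + c′) + σ (b * a ^ 3)     ≈⟨ +-cong (σ-+ x c′) (σ-* b (a ^ 3)) ⟩
      (σ x + σ c′) + c′ * σ (a ^ 3)  ≈⟨ +-cong (+-congˡ (σ³≈id a)) (*-congˡ (σ-^ 3 a)) ⟩
      (σ x + a) + c′ * b ^ 3         ∎

    σ²G : σ (σ (G x)) ≈ (σ (σ x) + b) + a * c′ ^ 3
    σ²G = begin
      σ (σ (G x))                       ≈⟨ σ-cong σG ⟩
      σ ((σ x + a) + c′ * b ^ 3)        ≈⟨ σ-+ _ _ ⟩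
      σ (σ x + a) + σ (c′ * b ^ 3)      ≈⟨ +-cong (σ-+ (σ x) a) (σ-* c′ (b ^ 3)) ⟩
      (σ (σ x) + b) + σ c′ * σ (b ^ 3)  ≈⟨ +-congˡ (*-cong (σ³≈id a) (σ-^ 3 b)) ⟩
      (σ (σ x) + b) + a * c′ ^ 3        ∎

  -- As `σ` fixes `N z`, the three conjugates are `N z` times b, c and a. Their product is a b c
  -- times the cube of `N z`.
  N⁴-conjugates : ∀ z → N z ^ 4 ≈ ((σ (s z) * N z) * σ (σ (s z) * N z)) * σ (σ (σ (s z) * N z))
  N⁴-conjugates z = begin
    N z ^ 4
      ≈⟨ solve 3 (λ a b c → let n = (a :* b) :* c in
           n :^ 4 := ((b :* n) :* (c :* n)) :* (a :* n)) refl a (σ a) (σ (σ a)) ⟩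
    ((σ a * N z) * (σ (σ a) * N z)) * (a * N z)
      ≈⟨ *-cong (*-congˡ σh) (trans (σ-cong σh) (trans (σ-* _ _) (*-cong (σ³≈id a) (σ-N z)))) ⟨
    ((σ a * N z) * σ (σ a * N z)) * σ (σ (σ a * N z)) ∎
    where
    a = s z

    σh : σ (σ a * N z) ≈ σ (σ a) * N z
    σh = trans (σ-* _ _) (*-congˡ (σ-N z))

  -- Every factor of `N z` is an iterated power of `s z`, and there are no nilpotents.
  N≈0⇒s≈0 : ∀ {z} → N z ≈ 0# → s z ≈ 0#
  N≈0⇒s≈0 eq with noZeroDivisors eq
  ... | inj₂ σ²s≈0 = x^n≈0⇒x≈0 (q ℕ.^ k) (x^n≈0⇒x≈0 (q ℕ.^ k) σ²s≈0)
  ... | inj₁ s*σs≈0 = [ id , x^n≈0⇒x≈0 (q ℕ.^ k) ]′ (noZeroDivisors s*σs≈0)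

  -- Injectivity

  module _ {x y : Carrier} (Gx≈Gy : G x ≈ G y) where

    private
      σs*N-agree : σ (s x) * N x ≈ σ (s y) * N y
      σs*N-agree = begin
        σ (s x) * N x      ≈⟨ σ²G+G≈σs*N x ⟨
        σ (σ (G x)) + G x  ≈⟨ +-cong (σ-cong (σ-cong Gx≈Gy)) Gx≈Gy ⟩
        σ (σ (G y)) + G y  ≈⟨ σ²G+G≈σs*N y ⟩
        σ (s y) * N y      ∎

      -- The fourth powers agree by `N⁴-conjugates`. Taking fourth powers is additive, so the sum of
      -- the two norms has fourth power zero.
      N-agree : N x ≈ N y
      N-agree = x+y≈0⇒x≈y (x^n≈0⇒x≈0 4 (begin
        (N x + N y) ^ 4    ≈⟨ ^q-homo-+ (N x) (N y) ⟩
        N x ^ 4 + N y ^ 4  ≈⟨ +-congʳ N⁴-agree ⟩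
        N y ^ 4 + N y ^ 4  ≈⟨ solve 1 (λ z → z :+ z := con false) refl (N y ^ 4) ⟩
        0#                 ∎))
        where
        N⁴-agree : N x ^ 4 ≈ N y ^ 4
        N⁴-agree = trans (N⁴-conjugates x) (trans
          (*-cong (*-cong σs*N-agree (σ-cong σs*N-agree)) (σ-cong (σ-cong σs*N-agree)))
          (sym (N⁴-conjugates y)))

      s-agree : s x ≈ s y
      s-agree with zero-or-inverse (N x)
      ... | inj₁ Nx≈0 = trans (N≈0⇒s≈0 {x} Nx≈0)
              (sym (N≈0⇒s≈0 {y} (trans (sym N-agree) Nx≈0)))
      ... | inj₂ inv  = begin
        s x              ≈⟨ σ³≈id (s x) ⟨
        -- Cancelling the common invertible norm identifies `σ (s x)` with `σ (s y)`; two further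
        -- applications of `σ` lead back to `s`.
        σ (σ (σ (s x)))  ≈⟨ σ-cong (σ-cong (cancelˡ inv (begin
            N x * σ (s x)  ≈⟨ *-comm _ _ ⟩
            σ (s x) * N x  ≈⟨ σs*N-agree ⟩
            σ (s y) * N y  ≈⟨ *-comm _ _ ⟩
            N y * σ (s y)  ≈⟨ *-congʳ N-agree ⟨
            N x * σ (s y)  ∎))) ⟩
        σ (σ (σ (s y)))  ≈⟨ σ³≈id (s y) ⟩
        s y              ∎

    G-injective : x ≈ y
    G-injective = begin
      x                                        ≈⟨ recover x ⟩
      (G x + σ (σ (s x))) + σ (s x) * s x ^ 3  ≈⟨ +-cong (+-cong Gx≈Gy (σ-cong (σ-cong s-agree)))
                                                           (*-cong (σ-cong s-agree) (^-congˡ 3 s-agree)) ⟩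
      (G y + σ (σ (s y))) + σ (s y) * s y ^ 3  ≈⟨ recover y ⟨
      y                                        ∎
      where
      -- Adding the last two terms of `G z` a second time cancels them in characteristic 2.
      recover : ∀ z → z ≈ (G z + σ (σ (s z))) + σ (s z) * s z ^ 3
      recover z = solve 3 (λ z u v → z := (((z :+ u) :+ v) :+ u) :+ v) refl z _ _

open import Data.Nat.Base using (_*_; _^_; _≤_)

theorem1p1 : {c ℓ₁ ℓ₂ : Level} (k : ℕ) → 1 ≤ k →
    (F : HeytingField c ℓ₁ ℓ₂) → HasOrder F (q ^ (3 * k)) →
    Polynomial.IsPermutationPolynomial (ring F) (g (ring F) k)
-- The field is finite, so injectivity suffices, and by `eval-g` it can be checked on `G`.
theorem1p1 k _ F enum = FiniteSetoid.injective⇒bijective enum (eval-cong (g (ring F) k))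
  λ {x} {y} eq → G-injective (trans (sym (eval-g x)) (trans eq (eval-g y)))
  where
  open CommutativeRing (ring F) using (sym; trans)
  open Evaluation (ring F) using (eval-cong)
  open Permutation F k enum using (G-injective; eval-g)
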